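{- There is no $\mathsf{LREC}[\{E\}]$-formula $\varphi(x,y)$ such that for all undirected graphs $G$ and all $v,w\in V(G)$: $G\models\varphi[v,w]$ if and only if there is a path from $v$ to $w$ in $G$.
   Context: Graphs are finite and viewed as structures over the vocabulary $\{E\}$ with $E$ binary (the edge relation); $x,y$ are structure variables. Basic conventions. $[m,n]=\{p\in\mathbb{N}: m\le p\le n\}$. A vocabulary $\tau$ is a finite set of relation symbols $R$ with arities $\mathrm{ar}(R)$. A $\tau$-structure $A$ has a non-empty finite universe $V(A)$ and relations $R(A)\subseteq V(A)^{\mathrm{ar}(R)}$. Every structure $A$ is equipped with a number sort $N(A)=[0,|V(A)|]$. Variables are either structure variables (ranging over $V(A)$) or number variables (ranging over $N(A)$); $A^u$ is $V(A)$ or $N(A)$ accordingly, and $A^{(u_1,\dots,u_k)}=A^{u_1}\times\dots\times A^{u_k}$. Two tuples of variables are compatible if they have the same length and the same types position by position. For a tuple $\bar u$, $\tilde u$ is the set of its entries. An assignment $\alpha$ in $A$ maps each variable $u$ to an element of $A^u$; $\alpha[\bar a/\bar u]$ is $\alpha$ modified to map $\bar u$ to $\bar a$. For $\bar n=(n_1,\dots,n_k)\in N(A)^k$ let $\langle\bar n\rangle=\langle\bar n\rangle_A=\sum_{i=1}^k n_i(|V(A)|+1)^{i-1}$. The logic $\mathsf{FO{+}C}[\tau]$ extends (two-sorted) first-order logic over $\tau$ by formulae $p\le q$ for number variables $p,q$, and $\#\bar u\,\psi=\bar p$ for a tuple $\bar u$ of variables, a tuple $\bar p$ of number variables and a formula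 $\psi$; the latter holds in $(A,\alpha)$ iff $|\{\bar a\in A^{\bar u}:(A,\alpha[\bar a/\bar u])\models\psi\}|=\langle\alpha(\bar p)\rangle_A$. Write $\varphi[A,\alpha;\bar u]=\{\bar a\in A^{\bar u}:(A,\alpha[\bar a/\bar u])\models\varphi\}$. The logic $\mathsf{LREC}$. $\mathsf{LREC}[\tau]$ is obtained by adding to the formation rules of $\mathsf{FO{+}C}[\tau]$ the rule: if $\bar u,\bar v,\bar w$ are compatible tuples of variables, $\bar p,\bar r$ are non-empty tuples of number variables, and $\varphi_E,\varphi_C$ are $\mathsf{LREC}[\tau]$-formulae, then $\varphi=[\mathrm{lrec}_{\bar u,\bar v,\bar p}\;\varphi_E,\varphi_C](\bar w,\bar r)$ is an $\mathsf{LREC}[\tau]$-formula, with free variables $(\mathrm{free}(\varphi_E)\setminus(\tilde u\cup\tilde v))\cup(\mathrm{free}(\varphi_C)\setminus(\tilde u\cup\tilde p))\cup\tilde w\cup\tilde r$. Semantics: given $(A,\alpha)$, let $\mathtt V=A^{\bar u}$, $\mathtt E=\varphi_E[A,\alpha;\bar u,\bar v]\subseteq\mathtt V^2$, and for $\bar a\in\mathtt V$ let $\mathtt C(\bar a)=\{\langle\bar n\rangle:\bar n\in\varphi_C[A,\alpha[\bar a/\bar u];\bar p]\}$, $\bar a\mathtt E=\{\bar b:\bar a\bar b\in\mathtt E\}$, $\mathtt E\bar b=\{\bar a:\bar a\bar b\in\mathtt E\}$. The relation $X\subseteq\mathtt V\times\mathbb N$ defined by $\varphi$ in $(A,\alpha)$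 is given recursively by: $(\bar a,\ell)\in X$ iff $\ell>0$ and $\bigl|\{\bar b\in\bar a\mathtt E:(\bar b,\lfloor(\ell-1)/|\mathtt E\bar b|\rfloor)\in X\}\bigr|\in\mathtt C(\bar a)$. Then $(A,\alpha)\models\varphi$ iff $(\alpha(\bar w),\langle\alpha(\bar r)\rangle)\in X$. -}

module Defs where

open import Data.Bool using (Bool; false; T; not; _∧_; _∨_)
open import Data.Bool.ListAction using (any; all)
open import Data.Fin using (Fin; zero; toℕ)
import Data.Fin.Properties as Fin
open import Data.List using (List; []; _∷_; _++_; [_]; length; replicate; filterᵇ; allFin; cartesianProductWith)
open import Data.List.Membership.Propositional using (_∈_)
open import Data.List.Relation.Unary.All as All using (All; []; _∷_)
open import Data.List.Relation.Unary.All.Properties using (++⁺)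
open import Data.Nat using (ℕ; zero; suc; _+_; _*_; _/_; _≤_; _<_; _≤ᵇ_; _≡ᵇ_; z≤n; s≤s)
open import Data.Nat.DivMod using (m/n≤m)
open import Data.Nat.Induction using (Acc; acc; <-wellFounded)
open import Data.Vec as Vec using (Vec; []; _∷_)
open import Relation.Binary.Construct.Closure.ReflexiveTransitive using (Star)
open import Relation.Binary.Definitions using (Symmetric; Irreflexive)
open import Relation.Binary.PropositionalEquality using (_≡_)
open import Relation.Nullary.Decidable using (⌊_⌋)

record Vocabulary : Set where
  field
    symbols : ℕ
    arity   : Fin symbols → ℕ

open Vocabulary public

-- The universe is Fin (suc n), so that it is finite and non-empty. Relations
-- on it are Bool-valued: classically this is every relation on a finite set.
record Structure (τ : Vocabulary) : Set where
  field
    n   : ℕ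
    rel : (R : Fin (symbols τ)) → Vec (Fin (suc n)) (arity τ R) → Bool

  order : ℕ
  order = suc n

  V : Set
  V = Fin order

open Structure public using (order; V; rel)

data Sort : Set where
  str num : Sort

Context : Set
Context = List Sort

-- Formulas are intrinsically scoped and sorted: LREC τ Γ consists of the
-- formulas whose free variables are among those declared in Γ. A binder for a
-- tuple of fresh, pairwise distinct variables of sorts Δ moves from Γ to
-- Δ ++ Γ, and compatible tuples are tuples with the same list of sorts Δ.
Var : Context → Sort → Set
Var Γ s = s ∈ Γ

Vars : Context → List Sort → Set
Vars Γ Δ = All (Var Γ) Δ

nums : ℕ → List Sort
nums k = replicate k num

data LREC (τ : Vocabulary) (Γ : Context) : Set where
  atom  : (R : Fin (symbols τ)) → Vec (Var Γ str) (arity τ R) → LREC τ Γ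
  _≐_   : ∀ {s} → Var Γ s → Var Γ s → LREC τ Γ
  _≼_   : Var Γ num → Var Γ num → LREC τ Γ
  neg   : LREC τ Γ → LREC τ Γ
  _and_ : LREC τ Γ → LREC τ Γ → LREC τ Γ
  _or_  : LREC τ Γ → LREC τ Γ → LREC τ Γ
  exi   : ∀ s → LREC τ (s ∷ Γ) → LREC τ Γ
  uni   : ∀ s → LREC τ (s ∷ Γ) → LREC τ Γ
  -- count Δ ψ k p̄  is  #ū ψ = p̄  with ū of sorts Δ and p̄ of length k.
  count : ∀ Δ (ψ : LREC τ (Δ ++ Γ)) k (p̄ : Vars Γ (nums k)) → LREC τ Γ
  -- lrec Δ k φE φC w̄ m r̄  is  [lrec_{ū,v̄,p̄} φE, φC](w̄, r̄)  with ū, v̄, w̄ of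
  -- sorts Δ, p̄ of length suc k and r̄ of length suc m. φE lives over ū, v̄, Γ
  -- and φC over p̄, ū, Γ.
  lrec  : ∀ Δ k (φE : LREC τ (Δ ++ (Δ ++ Γ)))
                (φC : LREC τ (nums (suc k) ++ (Δ ++ Γ)))
                (w̄ : Vars Γ Δ) m (r̄ : Vars Γ (nums (suc m))) → LREC τ Γ

-- The cardinality of { x in xs | p x }, for a duplicate-free list xs.
card : {X : Set} → List X → (X → Bool) → ℕ
card xs p = length (filterᵇ p xs)

-- Only ever relevant for a non-zero divisor.
_÷_ : ℕ → ℕ → ℕ
m ÷ zero  = zero
m ÷ suc d = m / suc d

÷-≤ : ∀ m d → m ÷ d ≤ m
÷-≤ m zero    = z≤n
÷-≤ m (suc d) = m/n≤m m (suc d)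

-- The relation X ⊆ 𝚅 × ℕ of the lrec operator, for the graph with vertex set 𝚅
-- (enumerated by vs), edges 𝙴 and labels 𝙲 (𝙲 a i means i ∈ 𝙲(a)):
-- (a , ℓ) ∈ X iff ℓ > 0 and |{ b ∈ a𝙴 | (b , ⌊(ℓ-1)/|𝙴b|⌋) ∈ X }| ∈ 𝙲(a).
-- If b ∈ a𝙴 then a ∈ 𝙴b, so |𝙴b| is non-zero wherever the quotient matters.
module LRecursion {𝚅 : Set} (vs : List 𝚅) (𝙴 : 𝚅 → 𝚅 → Bool) (𝙲 : 𝚅 → ℕ → Bool) where

  indeg : 𝚅 → ℕ
  indeg b = card vs (λ a → 𝙴 a b)

  X-acc : 𝚅 → (ℓ : ℕ) → Acc _<_ ℓ → Bool
  X-acc a zero    _        = false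
  X-acc a (suc ℓ) (acc rs) =
    𝙲 a (card vs (λ b → 𝙴 a b ∧ X-acc b (ℓ ÷ indeg b) (rs (s≤s (÷-≤ ℓ (indeg b))))))

  X : 𝚅 → ℕ → Bool
  X a ℓ = X-acc a ℓ (<-wellFounded ℓ)

module Semantics {τ : Vocabulary} (A : Structure τ) where

  -- N(A) = [0 , |V(A)|] is represented by Fin (suc |V(A)|).
  size : Sort → ℕ
  size str = order A
  size num = suc (order A)

  Dom : Sort → Set
  Dom s = Fin (size s)

  -- Tuples serves both for A^ū, with Δ the sorts of ū, and for assignments to
  -- a context. The modified assignment α[ā/ū] is ++⁺ ā α.
  Tuples : List Sort → Set
  Tuples Δ = All Dom Δ

  tuples : ∀ Δ → List (Tuples Δ)
  tuples []      = [ [] ]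
  tuples (s ∷ Δ) = cartesianProductWith _∷_ (allFin (size s)) (tuples Δ)

  -- Σᵢ nᵢ (|V(A)|+1)^(i-1), in Horner form.
  ⟨_⟩ : ∀ {k} → Tuples (nums k) → ℕ
  ⟨_⟩ {zero}  []      = 0
  ⟨_⟩ {suc k} (i ∷ n̄) = toℕ i + suc (order A) * ⟨_⟩ {k} n̄

  values : ∀ {Γ Δ} → Tuples Γ → Vars Γ Δ → Tuples Δ
  values α = All.map (All.lookup α)

  ⟦_⟧ : ∀ {Γ} → LREC τ Γ → Tuples Γ → Bool
  ⟦ atom R x̄ ⟧ α = rel A R (Vec.map (All.lookup α) x̄)
  ⟦ x ≐ y ⟧ α = ⌊ All.lookup α x Fin.≟ All.lookup α y ⌋
  ⟦ p ≼ q ⟧ α = toℕ (All.lookup α p) ≤ᵇ toℕ (All.lookup α q)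
  ⟦ neg φ ⟧ α = not (⟦ φ ⟧ α)
  ⟦ φ and ψ ⟧ α = ⟦ φ ⟧ α ∧ ⟦ ψ ⟧ α
  ⟦ φ or ψ ⟧ α = ⟦ φ ⟧ α ∨ ⟦ ψ ⟧ α
  ⟦ exi s φ ⟧ α = any (λ a → ⟦ φ ⟧ (a ∷ α)) (allFin (size s))
  ⟦ uni s φ ⟧ α = all (λ a → ⟦ φ ⟧ (a ∷ α)) (allFin (size s))
  ⟦ count Δ ψ k p̄ ⟧ α =
    card (tuples Δ) (λ ā → ⟦ ψ ⟧ (++⁺ ā α)) ≡ᵇ ⟨_⟩ {k} (values α p̄)
  ⟦ lrec Δ k φE φC w̄ m r̄ ⟧ α = X (values α w̄) (⟨_⟩ {suc m} (values α r̄))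
    where
    𝙴 : Tuples Δ → Tuples Δ → Bool
    𝙴 ā b̄ = ⟦ φE ⟧ (++⁺ ā (++⁺ b̄ α))

    𝙲 : Tuples Δ → ℕ → Bool
    𝙲 ā i = any (λ n̄ → (⟨_⟩ {suc k} n̄ ≡ᵇ i) ∧ ⟦ φC ⟧ (++⁺ n̄ (++⁺ ā α))) (tuples (nums (suc k)))

    open LRecursion (tuples Δ) 𝙴 𝙲

infix 4 _,_⊨_

_,_⊨_ : ∀ {τ Γ} (A : Structure τ) → Semantics.Tuples A Γ → LREC τ Γ → Set
A , α ⊨ φ = T (Semantics.⟦_⟧ A φ α)

-- The vocabulary {E} with E binary.
graphVocabulary : Vocabulary
graphVocabulary = record { symbols = 1 ; arity = λ _ → 2 }

Graph : Set
Graph = Structure graphVocabulary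

Edge : (G : Graph) → V G → V G → Set
Edge G v w = T (rel G zero (v ∷ w ∷ []))

-- Undirected graphs are taken to be loop-free. A formula that works for all
-- symmetric graphs works in particular for these, so non-definability over
-- loop-free graphs also covers the reading in which loops are allowed.
record Undirected (G : Graph) : Set where
  field
    symmetric   : Symmetric (Edge G)
    irreflexive : Irreflexive _≡_ (Edge G)

-- There is a path, possibly of length 0, from v to w.
Path : (G : Graph) → V G → V G → Set
Path G = Star (Edge G)

{-# OPTIONS --safe #-}
module Submission where

-- Consider two disjoint long cycles in which every vertex is replaced by n
-- twins, n being large compared with the length of the cycles. For given values
-- of the number variables and up to a renaming of twins, the truth value of an
-- LREC-formula depends only on the cyclic distances, up to a radius bounded by
-- the formula, between the vertices assigned to its structure variables; so it
-- cannot tell a remote vertex of the same cycle from a vertex of the other.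
-- For first-order and counting quantifiers this is the bijective
-- Ehrenfeucht–Fraïssé game. For lrec it must be shown that only boundedly many
-- steps ā → b̄ of the recursion lose radius. If some vertex of ā occurs neither
-- in b̄ nor among the parameters, then replacing it by its twins gives b̄
-- about n predecessors, so the resource, which is polynomial in n, drops by a
-- factor of about n: this happens boundedly often. Otherwise b̄ retains the
-- vertices of ā; it either gains a vertex, which happens at most |ā| times in
-- a row, or merely rearranges vertices whose distances are already controlled.

open import Defs
open import Data.Bool using (Bool; true; false; T; not; _∧_; _∨_)
open import Data.Bool.ListAction using (any; all)
open import Data.Bool.Properties using (T?; ∨-comm)
open import Data.Fin using (Fin; zero; suc; toℕ; combine; quotient; remainder)
open import Data.Fin.Permutation as Perm using (Permutation′; _⟨$⟩ʳ_; _⟨$⟩ˡ_; _∘ₚ_; transpose; permutation; inverseˡ; inverseʳ)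
open import Data.Fin.Properties using (_≟_; injective⇒≤; remQuot-combine; combine-remQuot; toℕ<n; toℕ-injective; toℕ-fromℕ<)
open import Data.List using (List; []; _∷_; _++_; length; lookup; map; filterᵇ; allFin; tabulate; cartesianProductWith; upTo)
open import Data.List.Properties using (length-++; length-map; filter-++; length-tabulate)
open import Data.List.Membership.Propositional using (_∈_; _∉_; find; lose)
open import Data.List.Membership.Propositional.Properties using (∈-++⁺ˡ; ∈-++⁺ʳ; ∈-++⁻; ∈-map⁺; ∈-filter⁺; ∈-allFin; ∈-upTo⁺; ∈-upTo⁻; ∈-cartesianProductWith⁺; ∈-cartesianProductWith⁻)
open import Data.List.Relation.Unary.Any using (here; there; index)
open import Data.List.Relation.Unary.Any.Properties using (lookup-index; any⁺; any⁻)
open import Data.List.Relation.Unary.All as All using (All; []; _∷_; all?)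
open import Data.List.Relation.Unary.All.Properties using (++⁺; ¬All⇒Any¬; lookup-map; map-∘; map-cong)
open import Data.List.Relation.Binary.Subset.Propositional using (_⊆_)
open import Data.Nat using (ℕ; zero; suc; _+_; _*_; _∸_; _^_; _/_; _%_; _⊔_; _≤_; _<_; _≡ᵇ_; z≤n; s≤s; s≤s⁻¹)
open import Data.Nat.DivMod using (_mod_; m<n*o⇒m/o<n; m≡m%n+[m/n]*n; %-distribˡ-+; m%n%n≡m%n; %-remove-+ʳ; m<n⇒m%n≡m; m%n<n; m∣n⇒o%n%m≡o%m)
open import Data.Nat.Divisibility using (_∣_; divides; n∣m*n)
open import Data.Nat.Induction using (Acc; acc; <-wellFounded)
open import Data.Nat.Properties hiding (_≟_)
open import Data.Product using (Σ-syntax; _×_; _,_; proj₁; proj₂)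
open import Data.Sum using (inj₁; inj₂)
open import Data.Vec using ([]; _∷_)
open import Function using (_∘_)
open import Function.Bundles using (_⇔_; mk⇔; Equivalence)
open import Relation.Binary.Construct.Closure.ReflexiveTransitive using (ε; _◅_; _◅◅_)
open import Relation.Binary.PropositionalEquality using (_≡_; _≢_; refl; sym; trans; cong; cong₂; subst; subst₂; module ≡-Reasoning)
open import Relation.Nullary using (¬_; Dec; yes; no; contradiction)
open import Relation.Nullary.Decidable using (⌊_⌋; toWitness; fromWitness; ¬?; _×-dec_)
import Data.List.Membership.DecPropositional as DecMembership
open import Algebra.Properties.CommutativeMonoid.Sum +-0-commutativeMonoid using (sum; sum-permute; sum-cong-≗)

open Equivalence using (to; from)

-- Counting

T-ext : ∀ {x y} → (T x → T y) → (T y → T x) → x ≡ y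
T-ext {false} {false} _ _ = refl
T-ext {false} {true}  _ g with () ← g _
T-ext {true}  {false} f _ with () ← f _
T-ext {true}  {true}  _ _ = refl

⌊⌋-cong : {A B : Set} (a? : Dec A) (b? : Dec B) → A ⇔ B → ⌊ a? ⌋ ≡ ⌊ b? ⌋
⌊⌋-cong (yes a) (yes b) _ = refl
⌊⌋-cong (yes a) (no ¬b) e = contradiction (to e a) ¬b
⌊⌋-cong (no ¬a) (yes b) e = contradiction (from e b) ¬a
⌊⌋-cong (no ¬a) (no ¬b) _ = refl

-- In the recursion it is the edge that forces an in-degree to be large, so the second conjuncts can
-- be compared only when the first holds.
∧-cong-if : ∀ {x x′ y y′} → x ≡ x′ → (T x → y ≡ y′) → x ∧ y ≡ x′ ∧ y′
∧-cong-if {false} refl _ = refl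
∧-cong-if {true}  refl f = f _

module _ {A : Set} where

  card-++ : ∀ (xs ys : List A) p → card (xs ++ ys) p ≡ card xs p + card ys p
  card-++ xs ys p = trans (cong length (filter-++ (T? ∘ p) xs ys)) (length-++ (filterᵇ p xs))

  card-map : {B : Set} (f : B → A) (xs : List B) → ∀ p → card (map f xs) p ≡ card xs (p ∘ f)
  card-map f []       p = refl
  card-map f (x ∷ xs) p with p (f x)
  ... | true  = cong suc (card-map f xs p)
  ... | false = card-map f xs p

  card-complement : ∀ (xs : List A) p → length xs ≡ card xs p + card xs (not ∘ p)
  card-complement []       p = refl
  card-complement (x ∷ xs) p with p x
  ... | true  = cong suc (card-complement xs p)
  ... | false = trans (cong suc (card-complement xs p)) (sym (+-suc _ _))

  card-mono : ∀ (xs : List A) {p q} → (∀ x → T (p x) → T (q x)) → card xs p ≤ card xs q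
  card-mono []       _ = z≤n
  card-mono (x ∷ xs) {p} {q} imp with p x | q x | imp x
  ... | true  | true  | _ = s≤s (card-mono xs imp)
  ... | true  | false | f with () ← f _
  ... | false | true  | _ = m≤n⇒m≤1+n (card-mono xs imp)
  ... | false | false | _ = card-mono xs imp

  card-mono-< : ∀ {xs : List A} {p q} → (∀ x → T (p x) → T (q x)) →
                ∀ {x} → x ∈ xs → ¬ T (p x) → T (q x) → card xs p < card xs q
  card-mono-< {x ∷ xs} {p} {q} imp (here refl) ¬px qx with p x | q x
  ... | true  | _    = contradiction _ ¬px
  ... | false | true = s≤s (card-mono xs imp)
  card-mono-< {y ∷ xs} {p} {q} imp (there x∈) ¬px qx with p y | q y | imp y
  ... | true  | true  | _ = s≤s (card-mono-< imp x∈ ¬px qx)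
  ... | true  | false | f with () ← f _
  ... | false | true  | _ = m≤n⇒m≤1+n (card-mono-< imp x∈ ¬px qx)
  ... | false | false | _ = card-mono-< imp x∈ ¬px qx

  any-cong : ∀ (xs : List A) {p q} → (∀ x → p x ≡ q x) → any p xs ≡ any q xs
  any-cong []       _  = refl
  any-cong (x ∷ xs) eq = cong₂ _∨_ (eq x) (any-cong xs eq)

  all-any : ∀ (xs : List A) p → all p xs ≡ not (any (not ∘ p) xs)
  all-any []       p = refl
  all-any (x ∷ xs) p with p x
  ... | true  = all-any xs p
  ... | false = refl

card-product : {A B C : Set} (_·_ : A → B → C) → ∀ {n} (g : Fin n → A) (ys : List B) p →
               card (cartesianProductWith _·_ (tabulate g) ys) p ≡ sum (λ i → card ys (λ y → p (g i · y)))
card-product _·_ {zero}  g ys p = refl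
card-product _·_ {suc n} g ys p =
  trans (card-++ (map (g zero ·_) ys) _ p)
        (cong₂ _+_ (card-map (g zero ·_) ys p) (card-product _·_ (g ∘ suc) ys p))

sum-permuted : ∀ {n} (π : Permutation′ n) {g h : Fin n → ℕ} → (∀ i → g i ≡ h (π ⟨$⟩ʳ i)) → sum g ≡ sum h
sum-permuted π {g} {h} eq = trans (sum-cong-≗ eq) (sym (sum-permute h π))

any-permuted : ∀ {n} (π : Permutation′ n) {p q : Fin n → Bool} → (∀ i → p i ≡ q (π ⟨$⟩ʳ i)) →
               any p (allFin n) ≡ any q (allFin n)
any-permuted π {p} {q} eq = T-ext
  (λ h → let (i , _ , pi) = find (any⁻ p (allFin _) h)
         in any⁺ q (lose {xs = allFin _} (∈-allFin (π ⟨$⟩ʳ i)) (subst T (eq i) pi)))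
  (λ h → let (i , _ , qi) = find (any⁻ q (allFin _) h)
         in any⁺ p (lose {xs = allFin _} (∈-allFin (π ⟨$⟩ˡ i)) (subst T (sym (trans (eq _) (cong q (inverseʳ π)))) qi)))

all-permuted : ∀ {n} (π : Permutation′ n) {p q : Fin n → Bool} → (∀ i → p i ≡ q (π ⟨$⟩ʳ i)) →
               all p (allFin n) ≡ all q (allFin n)
all-permuted π {p} {q} eq = trans (all-any (allFin _) p)
  (trans (cong not (any-permuted π (cong not ∘ eq))) (sym (all-any (allFin _) q)))

covering-length : ∀ {n} {xs : List (Fin n)} → (∀ i → i ∈ xs) → n ≤ length xs
covering-length {xs = xs} cover = injective⇒≤ {f = λ i → index (cover i)} λ {i} {j} eq →
  trans (lookup-index (cover i)) (trans (cong (lookup xs) eq) (sym (lookup-index (cover j))))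

-- `xs` may repeat entries, so the bound comes from the complement: `xs` and the elements failing
-- `p` together cover `Fin n`.
card-allFin≤ : ∀ {n} p (xs : List (Fin n)) → (∀ i → T (p i) → i ∈ xs) → card (allFin n) p ≤ length xs
card-allFin≤ {n} p xs inc = +-cancelʳ-≤ (card (allFin n) (not ∘ p)) _ _ (begin
  card (allFin n) p + card (allFin n) (not ∘ p)  ≡⟨ card-complement (allFin n) p ⟨
  length (allFin n)                              ≡⟨ length-tabulate _ ⟩
  n                                              ≤⟨ covering-length cover ⟩
  length (xs ++ filterᵇ (not ∘ p) (allFin n))    ≡⟨ length-++ xs ⟩
  length xs + card (allFin n) (not ∘ p)          ∎)
  where
  open ≤-Reasoning
  cover : ∀ i → i ∈ xs ++ filterᵇ (not ∘ p) (allFin n)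
  cover i with p i in eq
  ... | true  = ∈-++⁺ˡ (inc i (subst T (sym eq) _))
  ... | false = ∈-++⁺ʳ xs (∈-filter⁺ (T? ∘ not ∘ p) (∈-allFin i) (subst (T ∘ not) (sym eq) _))

-- Permutations

module _ {n : ℕ} where

  transpose-left : (i j : Fin n) → transpose i j ⟨$⟩ʳ i ≡ j
  transpose-left i j with i ≟ i
  ... | yes _  = refl
  ... | no i≢i = contradiction refl i≢i

  transpose-fix : (i j : Fin n) → ∀ {k} → k ≢ i → k ≢ j → transpose i j ⟨$⟩ʳ k ≡ k
  transpose-fix i j {k} k≢i k≢j with k ≟ i
  ... | yes k≡i = contradiction k≡i k≢i
  ... | no _ with k ≟ j
  ...   | yes k≡j = contradiction k≡j k≢j
  ...   | no _    = refl

  ⟨$⟩ʳ-injective : (π : Permutation′ n) → ∀ {i j} → π ⟨$⟩ʳ i ≡ π ⟨$⟩ʳ j → i ≡ j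
  ⟨$⟩ʳ-injective π eq = trans (sym (inverseˡ π)) (trans (cong (π ⟨$⟩ˡ_) eq) (inverseˡ π))

  -- Induction on the list: a permutation for the tail is followed by the transposition of the image
  -- of `x` with `y`. This can disturb a pair of the tail only if it has source `x` or target `y`,
  -- and then the equal patterns make it `(x , y)`.
  extend-to-permutation : (zs : List (Fin n × Fin n)) →
    (∀ {z z′} → z ∈ zs → z′ ∈ zs → proj₁ z ≡ proj₁ z′ ⇔ proj₂ z ≡ proj₂ z′) →
    Σ[ π ∈ Permutation′ n ] (∀ {z} → z ∈ zs → π ⟨$⟩ʳ proj₁ z ≡ proj₂ z)
  extend-to-permutation []             _       = Perm.id , λ ()
  extend-to-permutation ((x , y) ∷ zs) samePattern with extend-to-permutation zs (λ i j → samePattern (there i) (there j))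
  ... | π , matches = π ∘ₚ transpose (π ⟨$⟩ʳ x) y , matches′
    where
    matches′ : ∀ {z} → z ∈ (x , y) ∷ zs → transpose (π ⟨$⟩ʳ x) y ⟨$⟩ʳ (π ⟨$⟩ʳ proj₁ z) ≡ proj₂ z
    matches′ (here refl) = transpose-left (π ⟨$⟩ʳ x) y
    matches′ {z} (there z∈) with proj₁ z ≟ x
    ... | yes refl = trans (transpose-left (π ⟨$⟩ʳ x) y) (to (samePattern (here refl) (there z∈)) refl)
    ... | no z≢x   = trans (transpose-fix _ y (z≢x ∘ ⟨$⟩ʳ-injective π)
                             (λ eq → z≢x (from (samePattern (there z∈) (here refl)) (trans (sym (matches z∈)) eq))))
                           (matches z∈)

-- Quantifier rank and width

-- The radius that suffices for a recursion over k-tuples with resource ℓ < B ^ e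
-- at a tuple to which at most c further fresh vertices can be added, where every
-- in-degree at least B costs one power of B, and r₀ suffices for edges and labels.
radius : (k r₀ e c : ℕ) → ℕ
radius k r₀ e c = k * (e * suc k + c) + (k + r₀)

-- Distances up to `2 ^ rank φ` have to be controlled; a quantified variable doubles this. For
-- `lrec`, a resource with `suc m` digits in base |V| + 1, which will be at most `B ^ 2`, lies below
-- `B ^ (2 * suc m)`.
rank : ∀ {Γ} → LREC graphVocabulary Γ → ℕ
rank (atom R x̄)                = 0
rank (x ≐ y)                   = 0
rank (p ≼ q)                   = 0
rank (neg φ)                   = rank φ
rank (φ and ψ)                 = rank φ ⊔ rank ψ
rank (φ or ψ)                  = rank φ ⊔ rank ψ
rank (exi s φ)                 = suc (rank φ)
rank (uni s φ)                 = suc (rank φ)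
rank (count Δ ψ k p̄)           = length Δ + rank ψ
rank (lrec Δ k φE φC w̄ m r̄)    = radius (length Δ) (rank φE ⊔ rank φC) (2 * suc m) (length Δ)

-- Bounds the number of vertices in a successor tuple and the parameters together, for every `lrec`
-- inside: so many twins are set aside when predecessors are counted.
width : ∀ {Γ} → LREC graphVocabulary Γ → ℕ
width (atom R x̄)                   = 0
width (x ≐ y)                      = 0
width (p ≼ q)                      = 0
width (neg φ)                      = width φ
width (φ and ψ)                    = width φ ⊔ width ψ
width (φ or ψ)                     = width φ ⊔ width ψ
width (exi s φ)                    = width φ
width (uni s φ)                    = width φ
width (count Δ ψ k p̄)              = width ψ
width {Γ} (lrec Δ k φE φC w̄ m r̄)   = (length Δ + length Γ) ⊔ (width φE ⊔ width φC)

-- Blow-ups of cycles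

-- Every vertex p of the graph with edges p — s p, a disjoint union of cycles,
-- is replaced by suc n′ twins.
module BlowUp (c′ n′ : ℕ) (s : Permutation′ (suc c′)) where

  P Twin : Set
  P  = Fin (suc c′)
  Twin = Fin (suc n′)

  adjacent : P → P → Bool
  adjacent p q = ⌊ s ⟨$⟩ʳ p ≟ q ⌋ ∨ ⌊ s ⟨$⟩ʳ q ≟ p ⌋

  opaque
    pos : Fin (suc c′ * suc n′) → P
    pos = quotient {suc c′} (suc n′)

    twin : Fin (suc c′ * suc n′) → Twin
    twin = remainder {suc c′} (suc n′)

    pos-combine : ∀ p t → pos (combine p t) ≡ p
    pos-combine p t = cong proj₁ (remQuot-combine p t)

    twin-combine : ∀ p t → twin (combine {suc c′} p t) ≡ t
    twin-combine p t = cong proj₂ (remQuot-combine p t)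

    combine-pos-twin : ∀ v → combine (pos v) (twin v) ≡ v
    combine-pos-twin = combine-remQuot {suc c′} (suc n′)

  blowUp : Graph
  -- With this `n` the order computes to `suc c′ * suc n′`, so that vertices are pairs of a position
  -- and a twin.
  blowUp = record { n = n′ + c′ * suc n′ ; rel = λ { _ (v ∷ w ∷ []) → adjacent (pos v) (pos w) } }

  open Semantics blowUp public

  -- Steps along the cycles.

  shift : ℕ → P → P
  shift zero    p = p
  shift (suc d) p = s ⟨$⟩ʳ shift d p

  unshift : ℕ → P → P
  unshift zero    p = p
  unshift (suc d) p = unshift d (s ⟨$⟩ˡ p)

  shift-+ : ∀ d e p → shift (d + e) p ≡ shift d (shift e p)
  shift-+ zero    e p = refl
  shift-+ (suc d) e p = cong (s ⟨$⟩ʳ_) (shift-+ d e p)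

  shift-comm : ∀ d e p → shift d (shift e p) ≡ shift e (shift d p)
  shift-comm d e p = trans (sym (shift-+ d e p)) (trans (cong (λ k → shift k p) (+-comm d e)) (shift-+ e d p))

  shift-injective : ∀ d {p q} → shift d p ≡ shift d q → p ≡ q
  shift-injective zero    eq = eq
  shift-injective (suc d) eq = shift-injective d (⟨$⟩ʳ-injective s eq)

  shift-unshift : ∀ d p → shift d (unshift d p) ≡ p
  shift-unshift zero    p = refl
  shift-unshift (suc d) p = trans (cong (s ⟨$⟩ʳ_) (shift-unshift d (s ⟨$⟩ˡ p))) (inverseʳ s)

  shift-shift-unshift : ∀ D d p → shift D (shift d (unshift D p)) ≡ shift d p
  shift-shift-unshift D d p = trans (shift-comm D d _) (cong (shift d) (shift-unshift D p))

  adjacent⁻ : ∀ p q → T (adjacent p q) → Σ[ d ∈ ℕ ] Σ[ e ∈ ℕ ] shift d p ≡ shift e q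
  adjacent⁻ p q adj with s ⟨$⟩ʳ p ≟ q | s ⟨$⟩ʳ q ≟ p
  ... | yes eq | _      = 1 , 0 , eq
  ... | no _   | yes eq = 0 , 1 , sym eq

  adjacent-shift : ∀ p → T (adjacent p (shift 1 p))
  adjacent-shift p with shift 1 p ≟ shift 1 p
  ... | yes _ = _
  ... | no ¬p = contradiction refl ¬p

  undirected : (∀ p → shift 1 p ≢ p) → Undirected blowUp
  undirected moves = record
    { symmetric   = λ {v} {w} → subst T (∨-comm ⌊ s ⟨$⟩ʳ pos v ≟ pos w ⌋ _)
    ; irreflexive = λ { {v} refl → irreflexive v }
    }
    where
    irreflexive : ∀ v → ¬ T (adjacent (pos v) (pos v))
    irreflexive v adj with s ⟨$⟩ʳ pos v ≟ pos v
    ... | yes eq = moves (pos v) eq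
    ... | no _   = adj

  path-shift : ∀ d p t → Path blowUp (combine p t) (combine (shift d p) t)
  path-shift zero    p t = ε
  path-shift (suc d) p t = path-shift d p t ◅◅ (edge ◅ ε)
    where
    edge : Edge blowUp (combine (shift d p) t) (combine (shift (suc d) p) t)
    edge = subst₂ (λ p q → T (adjacent p q)) (sym (pos-combine _ t)) (sym (pos-combine _ t)) (adjacent-shift (shift d p))

  -- Permutations that respect twin classes, and the distances they preserve.

  record Fibred : Set where
    field
      perm : Permutation′ (suc c′ * suc n′)
      base : Permutation′ (suc c′)
      pos-perm : ∀ v → pos (perm ⟨$⟩ʳ v) ≡ base ⟨$⟩ʳ pos v

  open Fibred

  infixr 20 _·_

  _·_ : Fibred → V blowUp → V blowUp
  f · v = perm f ⟨$⟩ʳ v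

  relabel : Permutation′ (suc c′) → Fibred
  relabel ρ = record
    { perm     = permutation (move (ρ ⟨$⟩ʳ_)) (move (ρ ⟨$⟩ˡ_))
                   (move-inverse (ρ ⟨$⟩ʳ_) (ρ ⟨$⟩ˡ_) (λ _ → inverseʳ ρ))
                   (move-inverse (ρ ⟨$⟩ˡ_) (ρ ⟨$⟩ʳ_) (λ _ → inverseˡ ρ))
    ; base     = ρ
    ; pos-perm = λ v → pos-combine _ (twin v)
    }
    where
    move : (P → P) → V blowUp → V blowUp
    move g v = combine (g (pos v)) (twin v)
    move-inverse : ∀ g h → (∀ p → g (h p) ≡ p) → ∀ v → move g (move h v) ≡ v
    move-inverse g h gh v = trans
      (cong₂ (λ p t → combine (g p) t) (pos-combine _ (twin v)) (twin-combine (h (pos v)) _))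
      (trans (cong (λ p → combine p (twin v)) (gh (pos v))) (combine-pos-twin v))

  relabel-fix : ∀ ρ {v} → ρ ⟨$⟩ʳ pos v ≡ pos v → relabel ρ · v ≡ v
  relabel-fix ρ {v} fixed = trans (cong (λ p → combine p (twin v)) fixed) (combine-pos-twin v)

  _∘ᶠ_ : Fibred → Fibred → Fibred
  g ∘ᶠ f = record
    { perm     = perm f ∘ₚ perm g
    ; base     = base f ∘ₚ base g
    ; pos-perm = λ v → trans (pos-perm g _) (cong (base g ⟨$⟩ʳ_) (pos-perm f v))
    }

  swapTwins : ∀ v w → pos v ≡ pos w → Fibred
  swapTwins v w eq = record { perm = transpose v w ; base = Perm.id ; pos-perm = pos-transpose }
    where
    pos-transpose : ∀ u → pos (transpose v w ⟨$⟩ʳ u) ≡ pos u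
    pos-transpose u with u ≟ v
    ... | yes refl = sym eq
    ... | no _ with u ≟ w
    ...   | yes refl = eq
    ...   | no _     = refl

  Agree : Fibred → Fibred → List (V blowUp) → Set
  Agree f g S = ∀ {v} → v ∈ S → f · v ≡ g · v

  -- A `Fibred` map need not be an automorphism; on `S` it looks like one up to distance `2 ^ r`.
  -- Steps are directed, and both orders of `v` and `w` are included: `d = 0` is equality of
  -- positions, `d = 1` in either order is adjacency. Equality of vertices is preserved by any
  -- permutation.
  record Faithful (r : ℕ) (f : Fibred) (S : List (V blowUp)) : Set where
    constructor faithful
    field
      shifts : ∀ {v w} → v ∈ S → w ∈ S → ∀ {d} → d ≤ 2 ^ r →
               shift d (pos v) ≡ pos w ⇔ shift d (pos (f · v)) ≡ pos (f · w)

  open Faithful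

  module _ {r : ℕ} {f : Fibred} where

    Faithful-⊆ : ∀ {S S′} → S′ ⊆ S → Faithful r f S → Faithful r f S′
    Faithful-⊆ sub F = faithful λ v∈ w∈ → shifts F (sub v∈) (sub w∈)

    Faithful-≤ : ∀ {r′ S} → r′ ≤ r → Faithful r f S → Faithful r′ f S
    Faithful-≤ r′≤r F = faithful λ v∈ w∈ d≤ → shifts F v∈ w∈ (≤-trans d≤ (^-monoʳ-≤ 2 r′≤r))

    Faithful-agree : ∀ {g S} → Agree g f S → Faithful r f S → Faithful r g S
    Faithful-agree agree F = faithful λ v∈ w∈ {d} d≤ →
      subst₂ (λ x y → _ ⇔ shift d (pos x) ≡ pos y) (sym (agree v∈)) (sym (agree w∈)) (shifts F v∈ w∈ d≤)

  swapTwins-faithful : ∀ {r v w S} (eq : pos v ≡ pos w) → Faithful r (swapTwins v w eq) S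
  swapTwins-faithful {v = v} {w} eq = faithful λ {x} {y} _ _ {d} _ →
    subst₂ (λ p q → _ ⇔ shift d p ≡ q) (sym (pos-perm f x)) (sym (pos-perm f y)) (mk⇔ (λ e → e) (λ e → e))
    where f = swapTwins v w eq

  -- Tuples of vertices and numbers under fibred maps.

  elems : ∀ {Γ} → Tuples Γ → List (V blowUp)
  elems []                = []
  elems {str ∷ _} (v ∷ α) = v ∷ elems α
  elems {num ∷ _} (_ ∷ α) = elems α

  elems-++ : ∀ {Δ Γ} (a : Tuples Δ) (α : Tuples Γ) → elems (++⁺ a α) ≡ elems a ++ elems α
  elems-++ []                α = refl
  elems-++ {str ∷ _} (v ∷ a) α = cong (v ∷_) (elems-++ a α)
  elems-++ {num ∷ _} (_ ∷ a) α = elems-++ a α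

  elems-nums : ∀ k (n̄ : Tuples (nums k)) → elems n̄ ≡ []
  elems-nums zero    []      = refl
  elems-nums (suc k) (_ ∷ n̄) = elems-nums k n̄

  elems-length : ∀ {Γ} (α : Tuples Γ) → length (elems α) ≤ length Γ
  elems-length []                = z≤n
  elems-length {str ∷ _} (_ ∷ α) = s≤s (elems-length α)
  elems-length {num ∷ _} (_ ∷ α) = m≤n⇒m≤1+n (elems-length α)

  lookup∈elems : ∀ {Γ} (α : Tuples Γ) (x : Var Γ str) → All.lookup α x ∈ elems α
  lookup∈elems {str ∷ _} (_ ∷ α) (here refl) = here refl
  lookup∈elems {str ∷ _} (_ ∷ α) (there x)   = there (lookup∈elems α x)
  lookup∈elems {num ∷ _} (_ ∷ α) (there x)   = lookup∈elems α x

  elems⁻ : ∀ {Γ} (α : Tuples Γ) {v} → v ∈ elems α → Σ[ x ∈ Var Γ str ] All.lookup α x ≡ v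
  elems⁻ {str ∷ _} (_ ∷ α) (here refl) = here refl , refl
  elems⁻ {str ∷ _} (_ ∷ α) (there v∈) with x , eq ← elems⁻ α v∈ = there x , eq
  elems⁻ {num ∷ _} (_ ∷ α) v∈         with x , eq ← elems⁻ α v∈ = there x , eq

  elems-values : ∀ {Γ Δ} (α : Tuples Γ) (x̄ : Vars Γ Δ) → elems (values α x̄) ⊆ elems α
  elems-values {Δ = str ∷ _} α (x ∷ x̄) (here refl) = lookup∈elems α x
  elems-values {Δ = str ∷ _} α (x ∷ x̄) (there v∈)  = elems-values α x̄ v∈
  elems-values {Δ = num ∷ _} α (x ∷ x̄) v∈          = elems-values α x̄ v∈

  tuples-complete : ∀ {Δ} (a : Tuples Δ) → a ∈ tuples Δ
  tuples-complete []      = here refl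
  tuples-complete (v ∷ a) = ∈-cartesianProductWith⁺ _∷_ (∈-allFin v) (tuples-complete a)

  permˢ : Fibred → ∀ s → Permutation′ (size s)
  permˢ f str = perm f
  permˢ f num = Perm.id

  act : ∀ {Γ} → Fibred → Tuples Γ → Tuples Γ
  act f = All.map (λ {s} → permˢ f s ⟨$⟩ʳ_)

  act-++ : ∀ {Δ Γ} f (a : Tuples Δ) (α : Tuples Γ) → act f (++⁺ a α) ≡ ++⁺ (act f a) (act f α)
  act-++ f []      α = refl
  act-++ f (_ ∷ a) α = cong (_ ∷_) (act-++ f a α)

  act-nums : ∀ f k (n̄ : Tuples (nums k)) → act f n̄ ≡ n̄
  act-nums f zero    []      = refl
  act-nums f (suc k) (i ∷ n̄) = cong (i ∷_) (act-nums f k n̄)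

  act-values : ∀ {Γ Δ} f (α : Tuples Γ) (x̄ : Vars Γ Δ) → values (act f α) x̄ ≡ act f (values α x̄)
  act-values f α x̄ = trans (map-cong x̄ (lookup-map α)) (sym (map-∘ x̄))

  act-agree : ∀ {Γ f g} (α : Tuples Γ) → Agree f g (elems α) → act f α ≡ act g α
  act-agree []                _     = refl
  act-agree {str ∷ _} (_ ∷ α) agree = cong₂ _∷_ (agree (here refl)) (act-agree α (agree ∘ there))
  act-agree {num ∷ _} (i ∷ α) agree = cong (i ∷_) (act-agree α agree)

  act-id : ∀ {Γ f} (α : Tuples Γ) → (∀ {v} → v ∈ elems α → f · v ≡ v) → act f α ≡ α
  act-id []                _     = refl
  act-id {str ∷ _} (_ ∷ α) fixed = cong₂ _∷_ (fixed (here refl)) (act-id α (fixed ∘ there))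
  act-id {num ∷ _} (i ∷ α) fixed = cong (i ∷_) (act-id α fixed)

  ⟨⟩-bound : ∀ k (n̄ : Tuples (nums k)) → ⟨_⟩ {k} n̄ < suc (order blowUp) ^ k
  ⟨⟩-bound zero    []      = s≤s z≤n
  ⟨⟩-bound (suc k) (i ∷ n̄) = begin-strict
    toℕ i + N * ⟨_⟩ {k} n̄  <⟨ +-monoˡ-< _ (toℕ<n i) ⟩
    N + N * ⟨_⟩ {k} n̄      ≡⟨ *-suc N _ ⟨
    N * suc (⟨_⟩ {k} n̄)    ≤⟨ *-monoʳ-≤ N (⟨⟩-bound k n̄) ⟩
    N * N ^ k             ∎
    where
    open ≤-Reasoning
    N = suc (order blowUp)

  -- Counting the vertices of a tuple outside the parameters.

  open DecMembership (_≟_ {order blowUp}) using (_∈?_)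

  fresh? : ∀ A S (v : V blowUp) → Dec (v ∈ A × v ∉ S)
  fresh? A S v = (v ∈? A) ×-dec ¬? (v ∈? S)

  -- Counted over the universe, so that a vertex repeated in `A` counts once.
  fresh : List (V blowUp) → List (V blowUp) → ℕ
  fresh A S = card (allFin (order blowUp)) (λ v → ⌊ fresh? A S v ⌋)

  fresh-≤ : ∀ A S → fresh A S ≤ length A
  fresh-≤ A S = card-allFin≤ _ A (λ v Tv → proj₁ (toWitness {a? = fresh? A S v} Tv))

  module _ {A B S : List (V blowUp)} (A⊆ : A ⊆ B ++ S) where

    private
      step : ∀ v → T ⌊ fresh? A S v ⌋ → T ⌊ fresh? B S v ⌋
      step v Tv with toWitness {a? = fresh? A S v} Tv
      ... | v∈A , v∉S with ∈-++⁻ B (A⊆ v∈A)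
      ...   | inj₁ v∈B = fromWitness {a? = fresh? B S v} (v∈B , v∉S)
      ...   | inj₂ v∈S = contradiction v∈S v∉S

    fresh-mono : fresh A S ≤ fresh B S
    fresh-mono = card-mono (allFin _) step

    fresh-mono-< : ∀ {v} → v ∈ B → v ∉ A ++ S → fresh A S < fresh B S
    fresh-mono-< {v} v∈B v∉ = card-mono-< step (∈-allFin v)
      (λ Tv → v∉ (∈-++⁺ˡ (proj₁ (toWitness {a? = fresh? A S v} Tv))))
      (fromWitness {a? = fresh? B S v} (v∈B , v∉ ∘ ∈-++⁺ʳ A))

  -- One round of the bijective game.

  module Extension (homogeneous : ∀ d p q → shift d p ≡ p → shift d q ≡ q) where

    -- Positions at distance at most D from S follow their anchor in S: f is
    -- corrected by a permutation of positions, while the twins stay in place.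
    extension : ∀ {r f S} → Faithful (suc r) f S →
                Σ[ f′ ∈ Fibred ] (Agree f′ f S × (∀ b → Faithful r f′ (b ∷ S)))
    extension {r} {f} {S} F = f′ , agree , λ b → faithful (extended b)
      where
      D = 2 ^ r

      D+D : D + D ≡ 2 ^ suc r
      D+D = cong (D +_) (sym (+-identityʳ D))

      -- The window of `v`: as `e` runs from `0` to `D + D`, the positions from `D` steps before `v`
      -- to `D` steps after it, with `v` at `e = D`.
      point : V blowUp → ℕ → P
      point v e = shift e (unshift D (pos v))

      point-D+ : ∀ d v → point v (d + D) ≡ shift d (pos v)
      point-D+ d v = trans (shift-+ d D _) (cong (shift d) (shift-unshift D (pos v)))

      -- Applying shift D turns an equation between points into one that F controls.
      point-eq⁻ : ∀ {v w} e k → point v e ≡ point w (e + k) → pos v ≡ shift k (pos w)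
      point-eq⁻ {v} {w} e k eq = shift-injective e (begin
        shift e (pos v)                ≡⟨ shift-shift-unshift D e _ ⟨
        shift D (point v e)            ≡⟨ cong (shift D) eq ⟩
        shift D (point w (e + k))      ≡⟨ shift-shift-unshift D (e + k) _ ⟩
        shift (e + k) (pos w)          ≡⟨ shift-+ e k _ ⟩
        shift e (shift k (pos w))      ∎)
        where open ≡-Reasoning

      point-eq⁺ : ∀ {v w} e k → pos v ≡ shift k (pos w) → point v e ≡ point w (e + k)
      point-eq⁺ {v} {w} e k eq = shift-injective D (begin
        shift D (point v e)            ≡⟨ shift-shift-unshift D e _ ⟩
        shift e (pos v)                ≡⟨ cong (shift e) eq ⟩
        shift e (shift k (pos w))      ≡⟨ shift-+ e k _ ⟨
        shift (e + k) (pos w)          ≡⟨ shift-shift-unshift D (e + k) _ ⟨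
        shift D (point w (e + k))      ∎)
        where open ≡-Reasoning

      -- Points of two windows coincide only if one anchor is a shift of the other by the difference
      -- of the indices, which is at most `D + D`. Hence the exponent `suc r` in the hypothesis on
      -- `f`.
      point-≤ : ∀ {v w} → v ∈ S → w ∈ S → ∀ {e e′} → e ≤ e′ → e′ ≤ D + D →
                point v e ≡ point w e′ ⇔ point (f · v) e ≡ point (f · w) e′
      point-≤ {v} {w} v∈ w∈ {e} {e′} e≤e′ e′≤ with e′ ∸ e | m+[n∸m]≡n e≤e′
      ... | k | refl = mk⇔
        (λ eq → point-eq⁺ e k (sym (to   Fk (sym (point-eq⁻ e k eq)))))
        (λ eq → point-eq⁺ e k (sym (from Fk (sym (point-eq⁻ e k eq)))))
        where
        Fk = shifts F w∈ v∈ {k} (≤-trans (m≤n+m k e) (≤-trans e′≤ (≤-reflexive D+D)))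

      point-⇔ : ∀ {v w} → v ∈ S → w ∈ S → ∀ {e e′} → e ≤ D + D → e′ ≤ D + D →
                point v e ≡ point w e′ ⇔ point (f · v) e ≡ point (f · w) e′
      point-⇔ v∈ w∈ {e} {e′} e≤ e′≤ with ≤-total e e′
      ... | inj₁ e≤e′ = point-≤ v∈ w∈ e≤e′ e′≤
      ... | inj₂ e′≤e = mk⇔ (sym ∘ to eqv ∘ sym) (sym ∘ from eqv ∘ sym)
        where eqv = point-≤ w∈ v∈ e′≤e e≤

      -- The correction is applied after `f`, so it sends the place where `f` leaves a point to the
      -- corresponding point in the window of `f · v`.
      pair : V blowUp → ℕ → P × P
      pair v e = base f ⟨$⟩ʳ point v e , point (f · v) e

      pairs : List (P × P)
      pairs = cartesianProductWith pair S (upTo (suc (D + D)))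

      pairs-pattern : ∀ {z z′} → z ∈ pairs → z′ ∈ pairs → proj₁ z ≡ proj₁ z′ ⇔ proj₂ z ≡ proj₂ z′
      pairs-pattern z∈ z′∈
        with ∈-cartesianProductWith⁻ pair S (upTo (suc (D + D))) z∈
           | ∈-cartesianProductWith⁻ pair S (upTo (suc (D + D))) z′∈
      ... | v , e , v∈ , e∈ , refl | w , e′ , w∈ , e′∈ , refl =
        mk⇔ (to eqv ∘ ⟨$⟩ʳ-injective (base f)) (cong (base f ⟨$⟩ʳ_) ∘ from eqv)
        where eqv = point-⇔ v∈ w∈ (s≤s⁻¹ (∈-upTo⁻ e∈)) (s≤s⁻¹ (∈-upTo⁻ e′∈))

      matching = extend-to-permutation pairs pairs-pattern
      ρ  = proj₁ matching
      f′ = relabel ρ ∘ᶠ f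

      ρ-point : ∀ {v e} → v ∈ S → e ≤ D + D → ρ ⟨$⟩ʳ (base f ⟨$⟩ʳ point v e) ≡ point (f · v) e
      ρ-point v∈ e≤ = proj₂ matching (∈-cartesianProductWith⁺ pair v∈ (∈-upTo⁺ (s≤s e≤)))

      agree : Agree f′ f S
      agree {v} v∈ = relabel-fix ρ (begin
        ρ ⟨$⟩ʳ pos (f · v)             ≡⟨ cong (ρ ⟨$⟩ʳ_) (pos-perm f v) ⟩
        ρ ⟨$⟩ʳ (base f ⟨$⟩ʳ pos v)     ≡⟨ cong (λ p → ρ ⟨$⟩ʳ (base f ⟨$⟩ʳ p)) (point-D+ 0 v) ⟨
        ρ ⟨$⟩ʳ (base f ⟨$⟩ʳ point v D) ≡⟨ ρ-point v∈ (m≤m+n D D) ⟩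
        point (f · v) D                ≡⟨ point-D+ 0 (f · v) ⟩
        pos (f · v)                    ∎)
        where open ≡-Reasoning

      module _ {v} (v∈ : v ∈ S) (b : V blowUp) where

        -- `base f′` carries windows to windows and is injective, so one `f′` serves every `b`. This
        -- uniformity is what counting requires.
        at-point : ∀ {e} → e ≤ D + D → point v e ≡ pos b ⇔ point (f · v) e ≡ pos (f′ · b)
        at-point {e} e≤ = mk⇔
          (λ eq → trans (sym (ρ-point v∈ e≤)) (trans (cong (base f′ ⟨$⟩ʳ_) eq) (sym (pos-perm f′ b))))
          (λ eq → ⟨$⟩ʳ-injective (base f′) (trans (ρ-point v∈ e≤) (trans eq (pos-perm f′ b))))

        from-S : ∀ {d} → d ≤ D → shift d (pos v) ≡ pos b ⇔ shift d (pos (f′ · v)) ≡ pos (f′ · b)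
        from-S {d} d≤ = subst₂ (λ p q → p ≡ pos b ⇔ q ≡ pos (f′ · b))
          (point-D+ d v) (trans (point-D+ d (f · v)) (cong (shift d ∘ pos) (sym (agree v∈))))
          (at-point (+-monoˡ-≤ D d≤))

        -- Reaching `u` in `d` forward steps puts `p` at index `D ∸ d` of the window of `u`, which
        -- starts `D` steps before it.
        to-point : ∀ {d} → d ≤ D → ∀ u {p} → shift d p ≡ pos u ⇔ point u (D ∸ d) ≡ p
        to-point {d} d≤ u = mk⇔ (λ eq → shift-injective d (trans shifted (sym eq)))
                                (λ eq → trans (cong (shift d) (sym eq)) shifted)
          where
          shifted : shift d (point u (D ∸ d)) ≡ pos u
          shifted = trans (sym (shift-+ d (D ∸ d) _))
                          (trans (cong (λ k → point u k) (m+[n∸m]≡n d≤)) (shift-unshift D (pos u)))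

        into-S : ∀ {d} → d ≤ D → shift d (pos b) ≡ pos v ⇔ shift d (pos (f′ · b)) ≡ pos (f′ · v)
        into-S {d} d≤ = subst (λ u → shift d (pos b) ≡ pos v ⇔ shift d (pos (f′ · b)) ≡ pos u) (sym (agree v∈))
          (mk⇔ (from (to-point d≤ (f · v)) ∘ to   at ∘ to (to-point d≤ v))
               (from (to-point d≤ v)       ∘ from at ∘ to (to-point d≤ (f · v))))
          where at = at-point (≤-trans (m∸n≤m D d) (m≤m+n D D))

      extended : ∀ b {v w} → v ∈ b ∷ S → w ∈ b ∷ S → ∀ {d} → d ≤ D →
                 shift d (pos v) ≡ pos w ⇔ shift d (pos (f′ · v)) ≡ pos (f′ · w)
      -- Returns from `b` to itself depend only on the length of its cycle, and by `homogeneous` all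
      -- cycles are equally long.
      extended b (here refl) (here refl) {d} _ = mk⇔ (homogeneous d _ _) (homogeneous d _ _)
      extended b (here refl) (there w∈) d≤ = into-S w∈ b d≤
      extended b (there v∈) (here refl) d≤ = from-S v∈ b d≤
      extended b (there v∈) (there w∈) d≤  =
        shifts (Faithful-agree {g = f′} agree (Faithful-≤ (n≤1+n r) F)) v∈ w∈ d≤

    -- Counting tuples by playing the game componentwise.

    extensionˢ : ∀ {r f S} σ → Faithful (suc r) f S →
                 Σ[ f′ ∈ Fibred ] (Agree f′ f S × (∀ (b : Dom σ) → Faithful r f′ (elems {σ ∷ []} (b ∷ []) ++ S)))
    extensionˢ str F = extension F
    extensionˢ {r} {f} num F = f , (λ _ → refl) , λ _ → Faithful-≤ (n≤1+n r) F

    elems-∷ : ∀ {σ Δ} {S : List (V blowUp)} (v : Dom σ) (b : Tuples Δ) →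
              elems (v ∷ b) ++ S ⊆ elems b ++ (elems {σ ∷ []} (v ∷ []) ++ S)
    elems-∷ {str} v b (here refl) = ∈-++⁺ʳ (elems b) (here refl)
    elems-∷ {str} v b (there u∈) with ∈-++⁻ (elems b) u∈
    ... | inj₁ u∈b = ∈-++⁺ˡ u∈b
    ... | inj₂ u∈S = ∈-++⁺ʳ (elems b) (there u∈S)
    elems-∷ {num} v b u∈ = u∈

    -- The answer to the first component permutes the fibres, and inside each fibre the game goes on
    -- with the other components, each at the cost of one unit of the exponent. In the resulting
    -- bijection `f′` depends on `b`.
    card-tuples : ∀ Δ {r f S} {p q : Tuples Δ → Bool} → Faithful (length Δ + r) f S →
                  (∀ b f′ → Agree f′ f S → Faithful r f′ (elems b ++ S) → p b ≡ q (act f′ b)) →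
                  card (tuples Δ) p ≡ card (tuples Δ) q
    card-tuples [] {f = f} {p = p} {q} F eq with p [] | q [] | eq [] f (λ _ → refl) F
    ... | true  | true  | _ = refl
    ... | false | false | _ = refl
    card-tuples (σ ∷ Δ) {r} {f} {S} {p} {q} F eq with extensionˢ σ F
    ... | f₁ , agree₁ , F₁ = begin
      card (tuples (σ ∷ Δ)) p                        ≡⟨ card-product _∷_ (λ v → v) (tuples Δ) p ⟩
      sum (λ v → card (tuples Δ) (λ b → p (v ∷ b)))  ≡⟨ sum-permuted (permˢ f₁ σ) fibres ⟩
      sum (λ v → card (tuples Δ) (λ b → q (v ∷ b)))  ≡⟨ card-product _∷_ (λ v → v) (tuples Δ) q ⟨
      card (tuples (σ ∷ Δ)) q                        ∎
      where
      open ≡-Reasoning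
      head-agree : ∀ τ (v : Dom τ) {f′ g} → Agree f′ g (elems {τ ∷ []} (v ∷ []) ++ S) →
                   permˢ f′ τ ⟨$⟩ʳ v ≡ permˢ g τ ⟨$⟩ʳ v
      head-agree str v agree = agree (here refl)
      head-agree num v agree = refl

      fibres : ∀ v → card (tuples Δ) (λ b → p (v ∷ b)) ≡ card (tuples Δ) (λ b → q ((permˢ f₁ σ ⟨$⟩ʳ v) ∷ b))
      fibres v = card-tuples Δ {r} (F₁ v) λ b f′ agree F′ →
        trans (eq (v ∷ b) f′
                  (λ u∈ → trans (agree (∈-++⁺ʳ (elems {σ ∷ []} (v ∷ [])) u∈)) (agree₁ u∈))
                  (Faithful-⊆ (elems-∷ v b) F′))
              (cong (λ u → q (u ∷ act f′ b)) (head-agree σ v agree))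

    -- Invariance of the recursion.

    module Recursion
      -- Of the `suc n′` twins at a position, `q` are reserved for those occurring in a successor
      -- tuple or among the parameters; `B` remain interchangeable.
      (B q : ℕ) (B+q : suc n′ ≡ B + q) {Γ : Context} (Δ : List Sort) (narrow : length Δ + length Γ ≤ q)
      (𝙴 : Tuples Γ → Tuples Δ → Tuples Δ → Bool) (𝙲 : Tuples Γ → Tuples Δ → ℕ → Bool) (r₀ : ℕ)
      (𝙴-inv : ∀ f α a b → Faithful r₀ f (elems a ++ (elems b ++ elems α)) →
               𝙴 α a b ≡ 𝙴 (act f α) (act f a) (act f b))
      (𝙲-inv : ∀ f α a i → Faithful r₀ f (elems a ++ elems α) → 𝙲 α a i ≡ 𝙲 (act f α) (act f a) i)
      where

      module L (α : Tuples Γ) = LRecursion (tuples Δ) (𝙴 α) (𝙲 α)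

      k : ℕ
      k = length Δ

      -- A vertex of a that is neither in b nor in α can be replaced by any of
      -- its twins outside b and α.
      indeg-large : ∀ α {a b v} → T (𝙴 α a b) → v ∈ elems a → v ∉ elems b ++ elems α → B ≤ L.indeg α b
      indeg-large α {a} {b} {v} Eab v∈a v∉ with elems⁻ a v∈a
      ... | x , refl = +-cancelʳ-≤ q _ _ (begin
        B + q                                             ≡⟨ B+q ⟨
        suc n′                                            ≤⟨ covering-length cover ⟩
        length (predecessors ++ map twin others)          ≡⟨ length-++ predecessors ⟩
        length predecessors + length (map twin others)    ≡⟨ cong₂ _+_ (length-map _ (filterᵇ E (tuples Δ))) (length-map twin others) ⟩
        L.indeg α b + length others                       ≡⟨ cong (L.indeg α b +_) (length-++ (elems b)) ⟩
        L.indeg α b + (length (elems b) + length (elems α)) ≤⟨ +-monoʳ-≤ _ (≤-trans (+-mono-≤ (elems-length b) (elems-length α)) narrow) ⟩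
        L.indeg α b + q                                   ∎)
        where
        open ≤-Reasoning
        E : Tuples Δ → Bool
        E a′ = 𝙴 α a′ b
        others = elems b ++ elems α
        predecessors = map (λ a′ → twin (All.lookup a′ x)) (filterᵇ E (tuples Δ))

        cover : ∀ t → t ∈ predecessors ++ map twin others
        cover t with combine (pos v) t ∈? others
        ... | yes w∈ = ∈-++⁺ʳ predecessors (subst (_∈ map twin others) (twin-combine (pos v) t) (∈-map⁺ twin w∈))
        ... | no w∉  = ∈-++⁺ˡ (subst (_∈ predecessors) twin-image
                         (∈-map⁺ _ (∈-filter⁺ (T? ∘ E) (tuples-complete (act f a)) Efa)))
          where
          w = combine (pos v) t
          f = swapTwins v w (sym (pos-combine (pos v) t))

          fixed : ∀ {u} → u ∈ others → f · u ≡ u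
          fixed u∈ = transpose-fix v w (λ { refl → v∉ u∈ }) (λ { refl → w∉ u∈ })

          Efa : T (E (act f a))
          Efa = subst₂ (λ α′ b′ → T (𝙴 α′ (act f a) b′))
                  (act-id α (fixed ∘ ∈-++⁺ʳ (elems b))) (act-id b (fixed ∘ ∈-++⁺ˡ))
                  (subst T (𝙴-inv f α a b (swapTwins-faithful (sym (pos-combine (pos v) t)))) Eab)

          twin-image : twin (All.lookup (act f a) x) ≡ t
          twin-image = trans (cong twin (trans (lookup-map a x) (transpose-left v w))) (twin-combine (pos v) t)

      r₀≤radius : ∀ e c → r₀ ≤ radius k r₀ e c
      r₀≤radius e c = ≤-trans (m≤n+m r₀ k) (m≤n+m (k + r₀) (k * (e * suc k + c)))

      -- A step answers a new `k`-tuple and so spends `k`; the remainder has to suffice for whatever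
      -- follows.
      radius-step : ∀ e c → radius k r₀ (suc e) c ≡ k + (k * (k + e * suc k + c) + (k + r₀))
      radius-step e c = trans (cong (_+ (k + r₀)) (*-suc k (k + e * suc k + c))) (+-assoc k _ _)

      -- The weight `suc k` of `e` pays for the step itself and for resetting the budget `c` to `k`.
      radius-drop-e : ∀ e c → radius k r₀ e k ≤ k * (k + e * suc k + c) + (k + r₀)
      radius-drop-e e c = +-monoˡ-≤ (k + r₀) (*-monoʳ-≤ k
        (≤-trans (≤-reflexive (+-comm (e * suc k) k)) (m≤m+n (k + e * suc k) c)))

      radius-drop-c : ∀ e c → radius k r₀ (suc e) c ≡ k * (k + e * suc k + suc c) + (k + r₀)
      radius-drop-c e c = cong (λ j → k * j + (k + r₀)) (sym (+-suc (k + e * suc k) c))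

      -- An in-degree counts `k`-tuples, which costs `k` beyond the `r₀` for edges; this accounts
      -- for the summand `k + r₀` of `radius`.
      indeg-inv : ∀ {α α′} f {b b′} → α′ ≡ act f α → b′ ≡ act f b →
                  Faithful (k + r₀) f (elems b ++ elems α) → L.indeg α b ≡ L.indeg α′ b′
      indeg-inv {α} f {b} refl refl F = card-tuples Δ {r₀} F λ a f′ agree F′ →
        trans (𝙴-inv f′ α a b F′)
              (cong₂ (λ α″ b″ → 𝙴 α″ (act f′ a) b″)
                     (act-agree α (agree ∘ ∈-++⁺ʳ (elems b))) (act-agree b (agree ∘ ∈-++⁺ˡ)))

      ÷-drop : ∀ {ℓ d e} → suc ℓ < B ^ suc e → B ≤ d → ℓ ÷ d < B ^ e
      ÷-drop {ℓ} {suc d} {e} ℓ< B≤ = m<n*o⇒m/o<n (begin-strict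
        ℓ             <⟨ ≤-trans (n≤1+n _) ℓ< ⟩
        B * B ^ e     ≤⟨ *-monoˡ-≤ (B ^ e) B≤ ⟩
        suc d * B ^ e ≡⟨ *-comm (suc d) _ ⟩
        B ^ e * suc d ∎)
        where open ≤-Reasoning
      -- A zero divisor forces `B` to be zero, and nothing lies below a positive power of zero.
      ÷-drop {e = e} ℓ< z≤n with () ← ℓ<

      -- A step a → b falls under one of three cases: a loses a vertex and e
      -- drops; b gains a vertex and c drops; or b ⊆ a ∪ α and the whole radius
      -- is kept.
      X-inv : ∀ {α α′ ℓ ℓ′} (p : Acc _<_ ℓ) (p′ : Acc _<_ ℓ′) → ℓ ≡ ℓ′ →
              ∀ f {a a′} → α′ ≡ act f α → a′ ≡ act f a →
              -- `c` bounds the further vertices outside the parameters for which a tuple of length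
              -- `k` has room.
              ∀ e c → ℓ < B ^ e → k ≤ fresh (elems a) (elems α) + c →
              Faithful (radius k r₀ e c) f (elems a ++ elems α) →
              L.X-acc α a ℓ p ≡ L.X-acc α′ a′ ℓ′ p′
      X-inv {ℓ = zero} _ _ refl _ _ _ _ _ _ _ _ = refl
      X-inv {ℓ = suc ℓ} _ _ _ _ _ _ zero _ (s≤s ()) _ _
      X-inv {α} {ℓ = suc ℓ} (acc rs) (acc rs′) refl f {a} refl refl (suc e) c ℓ< budget F =
        trans (𝙲-inv f α a _ (Faithful-≤ (r₀≤radius (suc e) c) F))
              (cong (𝙲 (act f α) (act f a)) (card-tuples Δ {r} Fk successor))
        where
        r : ℕ
        r = k * (k + e * suc k + c) + (k + r₀)

        Fk : Faithful (k + r) f (elems a ++ elems α)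
        Fk = subst (λ ρ → Faithful ρ f (elems a ++ elems α)) (radius-step e c) F

        successor : ∀ b f′ → Agree f′ f (elems a ++ elems α) → Faithful r f′ (elems b ++ (elems a ++ elems α)) →
                    (𝙴 α a b ∧ L.X-acc α b (ℓ ÷ L.indeg α b) (rs (s≤s (÷-≤ ℓ (L.indeg α b))))) ≡
                    (𝙴 (act f α) (act f a) (act f′ b) ∧
                     L.X-acc (act f α) (act f′ b) (ℓ ÷ L.indeg (act f α) (act f′ b)) (rs′ (s≤s (÷-≤ ℓ (L.indeg (act f α) (act f′ b))))))
        successor b f′ agree F′ = ∧-cong-if 𝙴-eq X-eq
          where
          A = elems a
          C = elems b
          S = elems α

          α-eq : act f α ≡ act f′ α
          α-eq = sym (act-agree α (agree ∘ ∈-++⁺ʳ A))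

          a-eq : act f′ a ≡ act f a
          a-eq = act-agree a (agree ∘ ∈-++⁺ˡ)

          X₁ = L.X-acc α b (ℓ ÷ L.indeg α b) (rs (s≤s (÷-≤ ℓ (L.indeg α b))))
          X₂ = L.X-acc (act f α) (act f′ b) (ℓ ÷ L.indeg (act f α) (act f′ b))
                 (rs′ (s≤s (÷-≤ ℓ (L.indeg (act f α) (act f′ b)))))

          regroup : A ++ (C ++ S) ⊆ C ++ (A ++ S)
          regroup u∈ with ∈-++⁻ A u∈
          ... | inj₁ u∈A = ∈-++⁺ʳ C (∈-++⁺ˡ u∈A)
          ... | inj₂ u∈′ with ∈-++⁻ C u∈′
          ...   | inj₁ u∈C = ∈-++⁺ˡ u∈C
          ...   | inj₂ u∈S = ∈-++⁺ʳ C (∈-++⁺ʳ A u∈S)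

          F₁ : Faithful r f′ (A ++ (C ++ S))
          F₁ = Faithful-⊆ regroup F′

          F₂ : Faithful r f′ (C ++ S)
          F₂ = Faithful-⊆ (∈-++⁺ʳ A) F₁

          𝙴-eq : 𝙴 α a b ≡ 𝙴 (act f α) (act f a) (act f′ b)
          𝙴-eq = trans (𝙴-inv f′ α a b (Faithful-≤ (≤-trans (m≤n+m r₀ k) (m≤n+m (k + r₀) (k * (k + e * suc k + c)))) F₁))
                       (cong₂ (λ α″ a″ → 𝙴 α″ a″ (act f′ b)) (sym α-eq) a-eq)

          indeg-eq : L.indeg α b ≡ L.indeg (act f α) (act f′ b)
          indeg-eq = indeg-inv f′ α-eq refl (Faithful-≤ (m≤n+m (k + r₀) (k * (k + e * suc k + c))) F₂)

          next : ∀ e′ c′ → ℓ ÷ L.indeg α b < B ^ e′ → k ≤ fresh C S + c′ → Faithful (radius k r₀ e′ c′) f′ (C ++ S) →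
                 X₁ ≡ X₂
          -- The in-degrees on the two sides are only provably equal, hence the two resources and
          -- two accessibility proofs in `X-inv`.
          next = X-inv (rs _) (rs′ _) (cong (ℓ ÷_) indeg-eq) f′ α-eq refl

          ℓ÷< : ℓ ÷ L.indeg α b < B ^ suc e
          ℓ÷< = ≤-trans (s≤s (÷-≤ ℓ (L.indeg α b))) (≤-trans (n≤1+n _) ℓ<)

          grow : ∀ c → k ≤ fresh A S + c → fresh A S < fresh C S → Faithful (k * (k + e * suc k + c) + (k + r₀)) f′ (C ++ S) →
                 X₁ ≡ X₂
          -- With the budget spent, `a` already has `k` vertices outside the parameters, and `b`, of
          -- length `k`, cannot have more.
          grow zero    k≤ A<C _ = contradiction
            (≤-trans A<C (≤-trans (fresh-≤ C S) (elems-length b)))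
            (≤⇒≯ (subst (k ≤_) (+-identityʳ _) k≤))
          grow (suc c) k≤ A<C G = next (suc e) c ℓ÷<
            (≤-trans k≤ (≤-trans (≤-reflexive (+-suc _ c)) (+-monoˡ-≤ c A<C)))
            (subst (λ ρ → Faithful ρ f′ (C ++ S)) (sym (radius-drop-c e c)) G)

          X-eq : T (𝙴 α a b) →
                 X₁ ≡ X₂
          X-eq Eab with all? (_∈? (C ++ S)) A
          ... | no A⊈ with find (¬All⇒Any¬ (_∈? (C ++ S)) A A⊈)
          ...   | v , v∈A , v∉ = next e k (÷-drop {e = e} ℓ< (indeg-large α Eab v∈A v∉)) (m≤n+m k _)
                                  (Faithful-≤ (radius-drop-e e c) F₂)
          X-eq Eab | yes A⊆ with all? (_∈? (A ++ S)) C
          ... | no C⊈ with find (¬All⇒Any¬ (_∈? (A ++ S)) C C⊈)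
          ...   | v , v∈C , v∉ = grow c budget (fresh-mono-< (All.lookup A⊆) v∈C v∉) F₂
          -- All vertices of `b` lie where `f′` agrees with `f`, so the full exponent of `F` carries
          -- over rather than the `r` left after answering `b`. Such steps may therefore be repeated
          -- without bound.
          X-eq Eab | yes A⊆ | yes C⊆ = next (suc e) c ℓ÷<
            (≤-trans budget (+-monoˡ-≤ c (fresh-mono {A} {C} {S} (All.lookup A⊆))))
            (Faithful-⊆ C++S⊆ (Faithful-agree agree F))
            where
            C++S⊆ : C ++ S ⊆ A ++ S
            C++S⊆ u∈ with ∈-++⁻ C u∈
            ... | inj₁ u∈C = All.lookup C⊆ u∈C
            ... | inj₂ u∈S = ∈-++⁺ʳ A u∈S

    -- Invariance of all formulas.

    module Invariance (B q : ℕ) (B+q : suc n′ ≡ B + q) (large : suc (order blowUp) ≤ B ^ 2) where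

      ⟦_⟧-inv : ∀ {Γ} (φ : LREC graphVocabulary Γ) → width φ ≤ q →
                ∀ f α → Faithful (rank φ) f (elems α) → ⟦ φ ⟧ α ≡ ⟦ φ ⟧ (act f α)
      ⟦ atom zero (x ∷ y ∷ []) ⟧-inv _ f α F
        rewrite lookup-map {f = λ {s} → permˢ f s ⟨$⟩ʳ_} α x | lookup-map {f = λ {s} → permˢ f s ⟨$⟩ʳ_} α y =
        -- Adjacency is one step in either direction, and `2 ^ 0` allows one step.
        cong₂ _∨_ (⌊⌋-cong (_ ≟ _) (_ ≟ _) (shifts F (lookup∈elems α x) (lookup∈elems α y) {1} ≤-refl))
                  (⌊⌋-cong (_ ≟ _) (_ ≟ _) (shifts F (lookup∈elems α y) (lookup∈elems α x) {1} ≤-refl))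
      ⟦ _≐_ {s} x y ⟧-inv _ f α F
        rewrite lookup-map {f = λ {s} → permˢ f s ⟨$⟩ʳ_} α x | lookup-map {f = λ {s} → permˢ f s ⟨$⟩ʳ_} α y =
        ⌊⌋-cong (_ ≟ _) (_ ≟ _) (mk⇔ (cong (permˢ f s ⟨$⟩ʳ_)) (⟨$⟩ʳ-injective (permˢ f s)))
      ⟦ p ≼ r ⟧-inv _ f α F
        rewrite lookup-map {f = λ {s} → permˢ f s ⟨$⟩ʳ_} α p | lookup-map {f = λ {s} → permˢ f s ⟨$⟩ʳ_} α r = refl
      ⟦ neg φ ⟧-inv w f α F = cong not (⟦ φ ⟧-inv w f α F)
      ⟦ φ and ψ ⟧-inv w f α F = cong₂ _∧_
        (⟦ φ ⟧-inv (m⊔n≤o⇒m≤o _ _ w) f α (Faithful-≤ (m≤m⊔n _ _) F))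
        (⟦ ψ ⟧-inv (m⊔n≤o⇒n≤o _ _ w) f α (Faithful-≤ (m≤n⊔m (rank φ) _) F))
      ⟦ φ or ψ ⟧-inv w f α F = cong₂ _∨_
        (⟦ φ ⟧-inv (m⊔n≤o⇒m≤o _ _ w) f α (Faithful-≤ (m≤m⊔n _ _) F))
        (⟦ ψ ⟧-inv (m⊔n≤o⇒n≤o _ _ w) f α (Faithful-≤ (m≤n⊔m (rank φ) _) F))
      ⟦ exi s φ ⟧-inv w f α F with extensionˢ s F
      ... | f′ , agree , F′ = any-permuted (permˢ f′ s) λ v → trans
        (⟦ φ ⟧-inv w f′ (v ∷ α) (subst (Faithful _ f′) (sym (elems-++ {s ∷ []} (v ∷ []) α)) (F′ v)))
        (cong (λ β → ⟦ φ ⟧ ((permˢ f′ s ⟨$⟩ʳ v) ∷ β)) (act-agree α agree))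
      ⟦ uni s φ ⟧-inv w f α F with extensionˢ s F
      ... | f′ , agree , F′ = all-permuted (permˢ f′ s) λ v → trans
        (⟦ φ ⟧-inv w f′ (v ∷ α) (subst (Faithful _ f′) (sym (elems-++ {s ∷ []} (v ∷ []) α)) (F′ v)))
        (cong (λ β → ⟦ φ ⟧ ((permˢ f′ s ⟨$⟩ʳ v) ∷ β)) (act-agree α agree))
      ⟦ count Δ ψ k p̄ ⟧-inv w f α F = cong₂ _≡ᵇ_
        (card-tuples Δ {rank ψ} F λ b f′ agree F′ → trans
          (⟦ ψ ⟧-inv w f′ (++⁺ b α) (subst (Faithful _ f′) (sym (elems-++ b α)) F′))
          (cong ⟦ ψ ⟧ (trans (act-++ f′ b α) (cong (++⁺ (act f′ b)) (act-agree α agree)))))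
        (cong (⟨_⟩ {k}) (sym (trans (act-values f α p̄) (act-nums f k _))))
      ⟦_⟧-inv {Γ} (lrec Δ k φE φC w̄ m r̄) w f α F =
        -- The entries of `w̄` are parameters, so control over `elems α` suffices at the start,
        -- where the budget is the full `length Δ`.
        X-inv (<-wellFounded _) (<-wellFounded _)
          (cong (⟨_⟩ {suc m}) (sym (trans (act-values f α r̄) (act-nums f (suc m) _))))
          f refl (act-values f α w̄) (2 * suc m) (length Δ) resource (m≤n+m (length Δ) _) (Faithful-⊆ inside F)
        where
        w₁ : length Δ + length Γ ≤ q
        w₁ = m⊔n≤o⇒m≤o _ _ w
        w₂ : width φE ⊔ width φC ≤ q
        w₂ = m⊔n≤o⇒n≤o (length Δ + length Γ) _ w

        𝙴 : Tuples Γ → Tuples Δ → Tuples Δ → Bool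
        𝙴 α ā b̄ = ⟦ φE ⟧ (++⁺ ā (++⁺ b̄ α))

        𝙲 : Tuples Γ → Tuples Δ → ℕ → Bool
        𝙲 α ā i = any (λ n̄ → (⟨_⟩ {suc k} n̄ ≡ᵇ i) ∧ ⟦ φC ⟧ (++⁺ n̄ (++⁺ ā α))) (tuples (nums (suc k)))

        𝙴-inv : ∀ f α a b → Faithful (rank φE ⊔ rank φC) f (elems a ++ (elems b ++ elems α)) →
                𝙴 α a b ≡ 𝙴 (act f α) (act f a) (act f b)
        𝙴-inv f α a b F = trans
          (⟦ φE ⟧-inv (m⊔n≤o⇒m≤o _ _ w₂) f (++⁺ a (++⁺ b α))
            (subst (Faithful _ f) (sym (trans (elems-++ a (++⁺ b α)) (cong (elems a ++_) (elems-++ b α))))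
                   (Faithful-≤ (m≤m⊔n _ _) F)))
          (cong ⟦ φE ⟧ (trans (act-++ f a (++⁺ b α)) (cong (++⁺ (act f a)) (act-++ f b α))))

        𝙲-inv : ∀ f α a i → Faithful (rank φE ⊔ rank φC) f (elems a ++ elems α) →
                𝙲 α a i ≡ 𝙲 (act f α) (act f a) i
        𝙲-inv f α a i F = any-cong (tuples (nums (suc k))) λ n̄ → cong ((⟨_⟩ {suc k} n̄ ≡ᵇ i) ∧_) (trans
          (⟦ φC ⟧-inv (m⊔n≤o⇒n≤o (width φE) _ w₂) f (++⁺ n̄ (++⁺ a α))
            (subst (Faithful _ f)
                   (sym (trans (elems-++ n̄ (++⁺ a α)) (cong₂ _++_ (elems-nums (suc k) n̄) (elems-++ a α))))
                   (Faithful-≤ (m≤n⊔m (rank φE) _) F)))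
          (cong ⟦ φC ⟧ (trans (act-++ f n̄ (++⁺ a α)) (cong₂ ++⁺ (act-nums f (suc k) n̄) (act-++ f a α)))))

        open Recursion B q B+q Δ w₁ 𝙴 𝙲 (rank φE ⊔ rank φC) 𝙴-inv 𝙲-inv

        resource : ⟨_⟩ {suc m} (values α r̄) < B ^ (2 * suc m)
        resource = begin-strict
          ⟨_⟩ {suc m} (values α r̄)       <⟨ ⟨⟩-bound (suc m) (values α r̄) ⟩
          suc (order blowUp) ^ suc m    ≤⟨ ^-monoˡ-≤ (suc m) large ⟩
          (B ^ 2) ^ suc m               ≡⟨ ^-*-assoc B 2 (suc m) ⟩
          B ^ (2 * suc m)               ∎
          where open ≤-Reasoning

        inside : elems (values α w̄) ++ elems α ⊆ elems α
        inside v∈ with ∈-++⁻ (elems (values α w̄)) v∈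
        ... | inj₁ v∈w = elems-values α w̄ v∈w
        ... | inj₂ v∈α = v∈α

-- Rotations of ℤ/N

module Rotation (c′ : ℕ) where

  N : ℕ
  N = suc c′

  toℕ-mod : ∀ m → toℕ (m mod N) ≡ m % N
  toℕ-mod m = toℕ-fromℕ< (m%n<n m N)

  %-+ : ∀ m k → (m % N + k) % N ≡ (m + k) % N
  %-+ m k = trans (%-distribˡ-+ (m % N) k N)
    (trans (cong (λ x → (x + k % N) % N) (m%n%n≡m%n m N)) (sym (%-distribˡ-+ m k N)))

  turn : ℕ → Fin N → Fin N
  turn k i = (toℕ i + k) mod N

  turn-turn : ∀ j k → N ∣ j + k → ∀ i → turn k (turn j i) ≡ i
  turn-turn j k N∣ i = toℕ-injective (begin
    toℕ (turn k (turn j i))      ≡⟨ toℕ-mod (toℕ (turn j i) + k) ⟩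
    (toℕ (turn j i) + k) % N     ≡⟨ cong (λ x → (x + k) % N) (toℕ-mod (toℕ i + j)) ⟩
    ((toℕ i + j) % N + k) % N    ≡⟨ %-+ (toℕ i + j) k ⟩
    (toℕ i + j + k) % N          ≡⟨ cong (_% N) (+-assoc (toℕ i) j k) ⟩
    (toℕ i + (j + k)) % N        ≡⟨ %-remove-+ʳ (toℕ i) N∣ ⟩
    toℕ i % N                    ≡⟨ m<n⇒m%n≡m (toℕ<n i) ⟩
    toℕ i                        ∎)
    where open ≡-Reasoning

  opaque
    rotate : ℕ → Permutation′ N
    -- Modulo `suc c′`, adding `k * c′` undoes adding `k`.
    rotate k = permutation (turn k) (turn (k * c′))
      (turn-turn (k * c′) k (divides k (trans (+-comm (k * c′) k) (sym (*-suc k c′)))))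
      (turn-turn k (k * c′) (divides k (sym (*-suc k c′))))

    toℕ-rotate : ∀ k i → toℕ (rotate k ⟨$⟩ʳ i) ≡ (toℕ i + k) % N
    toℕ-rotate k i = toℕ-mod (toℕ i + k)

-- Rotation by 2 has two cycles, the even and the odd numbers, if N is even.
module TwoCycles (D n′ : ℕ) where

  -- `N` is `(2 + (D + D)) * 2`: each cycle has length `2 + (D + D)`, so opposite positions are
  -- `suc D` steps apart both ways, just beyond `D`.
  open Rotation (3 + (D + D) * 2) public
  open BlowUp (3 + (D + D) * 2) n′ (rotate 2) public

  toℕ-shift : ∀ d p → toℕ (shift d p) ≡ (toℕ p + d * 2) % N
  toℕ-shift zero    p = trans (sym (m<n⇒m%n≡m (toℕ<n p))) (cong (_% N) (sym (+-identityʳ (toℕ p))))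
  toℕ-shift (suc d) p = begin
    toℕ (shift (suc d) p)           ≡⟨ toℕ-rotate 2 _ ⟩
    (toℕ (shift d p) + 2) % N       ≡⟨ cong (λ x → (x + 2) % N) (toℕ-shift d p) ⟩
    ((toℕ p + d * 2) % N + 2) % N   ≡⟨ %-+ (toℕ p + d * 2) 2 ⟩
    (toℕ p + d * 2 + 2) % N         ≡⟨ cong (_% N) (trans (+-assoc (toℕ p) (d * 2) 2) (cong (toℕ p +_) (+-comm (d * 2) 2))) ⟩
    (toℕ p + suc d * 2) % N         ∎
    where open ≡-Reasoning

  -- `shift d` adds `d * 2`, so it fixes a position exactly when `N` divides `d * 2`, whatever the
  -- position.
  homogeneous : ∀ d p q → shift d p ≡ p → shift d q ≡ q
  homogeneous d p q fixed = toℕ-injective (begin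
    toℕ (shift d q)          ≡⟨ toℕ-shift d q ⟩
    (toℕ q + d * 2) % N      ≡⟨ %-remove-+ʳ (toℕ q) (divides k (+-cancelˡ-≡ (toℕ p) _ _ period)) ⟩
    toℕ q % N                ≡⟨ m<n⇒m%n≡m (toℕ<n q) ⟩
    toℕ q                    ∎)
    where
    open ≡-Reasoning
    k = (toℕ p + d * 2) / N
    period : toℕ p + d * 2 ≡ toℕ p + k * N
    period = begin
      toℕ p + d * 2                     ≡⟨ m≡m%n+[m/n]*n (toℕ p + d * 2) N ⟩
      (toℕ p + d * 2) % N + k * N       ≡⟨ cong (_+ k * N) (trans (sym (toℕ-shift d p)) (cong toℕ fixed)) ⟩
      toℕ p + k * N                     ∎

  open Extension homogeneous public

  parity : V blowUp → ℕ
  parity v = toℕ (pos v) % 2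

  -- The step and `N` are both even, so parity survives reduction modulo `N`; it tells the two
  -- cycles apart.
  parity-shift : ∀ d p → toℕ (shift d p) % 2 ≡ toℕ p % 2
  parity-shift d p = begin
    toℕ (shift d p) % 2             ≡⟨ cong (_% 2) (toℕ-shift d p) ⟩
    (toℕ p + d * 2) % N % 2         ≡⟨ m∣n⇒o%n%m≡o%m 2 N (toℕ p + d * 2) (n∣m*n (2 + (D + D))) ⟩
    (toℕ p + d * 2) % 2             ≡⟨ %-remove-+ʳ (toℕ p) (n∣m*n d) ⟩
    toℕ p % 2                       ∎
    where open ≡-Reasoning

  small : ∀ {m} → m ≤ D + D → suc m * 2 < N
  small m≤ = *-monoˡ-< 2 (s≤s (s≤s m≤))

  shift-1-≢ : ∀ p → shift 1 p ≢ p
  shift-1-≢ p fixed = 0≢1+n (begin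
    0                     ≡⟨ cong toℕ (homogeneous 1 p zero fixed) ⟨
    toℕ (shift 1 zero)    ≡⟨ toℕ-shift 1 zero ⟩
    2 % N                 ≡⟨ m<n⇒m%n≡m (small z≤n) ⟩
    2                     ∎)
    where open ≡-Reasoning

  path-parity : ∀ {v w} → Path blowUp v w → parity v ≡ parity w
  path-parity ε = refl
  path-parity {v} (_◅_ {j = u} e path) with adjacent⁻ (pos v) (pos u) e
  ... | d , d′ , eq = trans (sym (parity-shift d (pos v)))
    (trans (cong (λ p → toℕ p % 2) eq) (trans (parity-shift d′ (pos u)) (path-parity path)))

  -- A connected and an unconnected pair that agree on short distances.

  origin antipode other : Fin N
  origin   = zero
  antipode = shift (suc D) origin
  other    = suc zero

  toℕ-antipode : toℕ antipode ≡ suc D * 2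
  toℕ-antipode = trans (toℕ-shift (suc D) origin) (m<n⇒m%n≡m (small (m≤m+n D D)))

  v w w′ : V blowUp
  v  = combine origin (zero {n = n′})
  w  = combine antipode (zero {n = n′})
  w′ = combine other (zero {n = n′})

  -- Exchanges the twin class opposite `v` with one of the other cycle. Edges at `w` break, but only
  -- distances between `v` and `w` have to be respected.
  f : Fibred
  f = relabel (transpose antipode other)

  f-v : f · v ≡ v
  f-v = relabel-fix (transpose antipode other) (trans (cong (transpose antipode other ⟨$⟩ʳ_) (pos-combine origin zero))
    (trans (transpose-fix antipode other (λ eq → 0≢1+n (trans (cong toℕ eq) toℕ-antipode)) (λ ()))
           (sym (pos-combine origin zero))))

  f-w : f · w ≡ w′
  f-w = cong₂ combine
    (trans (cong (transpose antipode other ⟨$⟩ʳ_) (pos-combine antipode zero)) (transpose-left antipode other))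
    (twin-combine antipode zero)

  ¬shift-antipode : ∀ {d} → d ≤ D → shift d origin ≢ antipode
  ¬shift-antipode {zero}  _   eq = 0≢1+n (trans (cong toℕ eq) toℕ-antipode)
  ¬shift-antipode {suc d} d<D eq = <-irrefl (*-cancelʳ-≡ (suc d) (suc D) 2 (begin
    suc d * 2                ≡⟨ m<n⇒m%n≡m (small (≤-trans (≤-trans (n≤1+n d) d<D) (m≤m+n D D))) ⟨
    (suc d * 2) % N          ≡⟨ toℕ-shift (suc d) origin ⟨
    toℕ (shift (suc d) origin) ≡⟨ cong toℕ eq ⟩
    toℕ antipode             ≡⟨ toℕ-antipode ⟩
    suc D * 2                ∎)) (s≤s d<D)
    where open ≡-Reasoning

  -- Counted from the origin these are at most `D + suc D` steps, one short of a full turn.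
  ¬shift-from-antipode : ∀ {d} → d ≤ D → shift d antipode ≢ origin
  ¬shift-from-antipode {d} d≤D eq = 0≢1+n {n = suc (D + d) * 2 ∸ 1} (begin
    0                                    ≡⟨ cong toℕ eq ⟨
    toℕ (shift d antipode)               ≡⟨ cong toℕ (shift-+ d (suc D) origin) ⟨
    toℕ (shift (d + suc D) origin)       ≡⟨ cong (λ k → toℕ (shift k origin)) (trans (+-suc d D) (cong suc (+-comm d D))) ⟩
    toℕ (shift (suc (D + d)) origin)     ≡⟨ toℕ-shift (suc (D + d)) origin ⟩
    (suc (D + d) * 2) % N                ≡⟨ m<n⇒m%n≡m (small (+-monoʳ-≤ D d≤D)) ⟩
    suc (D + d) * 2                      ∎)
    where open ≡-Reasoning

  ¬shift-parity : ∀ d {p q} → toℕ p % 2 ≢ toℕ q % 2 → shift d p ≢ q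
  ¬shift-parity d {p} p≢q eq = p≢q (trans (sym (parity-shift d p)) (cong (λ x → toℕ x % 2) eq))

  -- Between different vertices every short shift fails on both sides: before `f` because they are
  -- more than `D` steps apart, after it because their parities differ.
  f-faithful : ∀ {r} → 2 ^ r ≡ D → Faithful r f (v ∷ w ∷ [])
  f-faithful {r} refl = faithful λ x∈ y∈ d≤ → distances x∈ y∈ d≤
    where
    both-false : ∀ {A B : Set} → ¬ A → ¬ B → A ⇔ B
    both-false ¬a ¬b = mk⇔ (λ a → contradiction a ¬a) (λ b → contradiction b ¬b)

    distances : ∀ {x y} → x ∈ v ∷ w ∷ [] → y ∈ v ∷ w ∷ [] → ∀ {d} → d ≤ 2 ^ r →
                shift d (pos x) ≡ pos y ⇔ shift d (pos (f · x)) ≡ pos (f · y)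
    distances (here refl) (here refl) {d} _ = mk⇔ (homogeneous d _ _) (homogeneous d _ _)
    distances (there (here refl)) (there (here refl)) {d} _ = mk⇔ (homogeneous d _ _) (homogeneous d _ _)
    distances (here refl) (there (here refl)) {d} d≤
      rewrite f-v | f-w | pos-combine origin (zero {n = n′}) | pos-combine antipode (zero {n = n′})
            | pos-combine other (zero {n = n′}) =
      both-false (¬shift-antipode d≤) (¬shift-parity d {origin} {other} λ ())
    distances (there (here refl)) (here refl) {d} d≤
      rewrite f-v | f-w | pos-combine origin (zero {n = n′}) | pos-combine antipode (zero {n = n′})
            | pos-combine other (zero {n = n′}) =
      both-false (¬shift-from-antipode d≤) (¬shift-parity d {other} {origin} λ ())

-- Choice of cycle length and number of twins for a given formula.

theorem5p1 : ¬ (Σ[ φ ∈ LREC graphVocabulary (str ∷ str ∷ []) ] ((G : Graph) → Undirected G → (v w : V G) → (G , v ∷ w ∷ [] ⊨ φ) ⇔ Path G v w))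
theorem5p1 (φ , defines) = ¬path (to (defines blowUp (undirected shift-1-≢) v w′) holds′)
  where
  c q : ℕ
  c = (2 + (2 ^ rank φ + 2 ^ rank φ)) * 2
  q = width φ

  -- The rank fixes the number `c` of positions, and only then the number of twins is chosen: it
  -- computes to `B + q`. The order is then `c * (B + q)`, and `B` exceeds `c + c * q` by one just
  -- to keep the order below `B ^ 2`.
  open TwoCycles (2 ^ rank φ) (c + c * q + q)

  B : ℕ
  B = suc (c + c * q)

  large : suc (order blowUp) ≤ B ^ 2
  large = begin
    suc (c * (B + q))         ≡⟨ cong suc (*-distribˡ-+ c B q) ⟩
    suc (c * B + c * q)       ≡⟨ +-suc (c * B) (c * q) ⟨
    c * B + suc (c * q)       ≤⟨ +-monoʳ-≤ (c * B) (m≤m*n (suc (c * q)) B) ⟩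
    c * B + suc (c * q) * B   ≡⟨ *-distribʳ-+ B c (suc (c * q)) ⟨
    (c + suc (c * q)) * B     ≡⟨ cong (_* B) (+-suc c (c * q)) ⟩
    B * B                     ≡⟨ cong (B *_) (*-identityʳ B) ⟨
    B ^ 2                     ∎
    where open ≤-Reasoning

  open Invariance B q refl large

  path : Path blowUp v w
  path = path-shift (suc (2 ^ rank φ)) origin zero

  invariant : ⟦ φ ⟧ (v ∷ w ∷ []) ≡ ⟦ φ ⟧ (v ∷ w′ ∷ [])
  invariant = trans (⟦ φ ⟧-inv ≤-refl f (v ∷ w ∷ []) (f-faithful refl))
                    (cong₂ (λ x y → ⟦ φ ⟧ (x ∷ y ∷ [])) f-v f-w)

  holds′ : blowUp , v ∷ w′ ∷ [] ⊨ φ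
  holds′ = subst T invariant (from (defines blowUp (undirected shift-1-≢) v w) path)

  ¬path : ¬ Path blowUp v w′
  ¬path p with trans (sym (cong (λ p → toℕ p % 2) (pos-combine origin zero)))
                     (trans (path-parity p) (cong (λ p → toℕ p % 2) (pos-combine other zero)))
  ... | ()
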